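{- There is an absolute constant $C>0$ such that for every access sequence $X=(x_1,\dots,x_m)\in[n]^m$ in which no key value appears twice, and for every reference tree $\mathcal{T}$ for $G_X$, we have $\mathsf{Alt}_\mathcal{T}(X)\le C\,(\mathsf{Funnel}(X)+m)$.
   Context: Geometric view: for $X=(x_1,\dots,x_m)$ let $G_X=\{(x_i,i): i\in[m]\}\subset\mathbb{R}^2$. For a point $p$ write $p.x,p.y$ for its coordinates, and for a set $P$ write $P.x=\{p.x:p\in P\}$, $P.y=\{p.y:p\in P\}$. Mixing value: for disjoint finite sets $L,R\subset\mathbb{R}$, $\mathrm{mix}(L,R)\in\{\mathtt{L},\mathtt{R}\}^*$ is the word obtained by listing $L\cup R$ in increasing order and writing $\mathtt{L}$ for elements of $L$ and $\mathtt{R}$ for elements of $R$; $\mathrm{blocks}(s)$ is $0$ for the empty word and otherwise $1+\#\{i: s_i\ne s_{i+1}\}$ (the number of maximal runs of equal letters); $\mathrm{mixValue}(L,R)=\mathrm{blocks}(\mathrm{mix}(L,R))$. Alternation bound: let $P$ be a finite point set with distinct $y$-coordinates. A reference tree for $P$ is a binary tree in which every non-leaf node has exactly two children and whose leaves are labeled by the elements of $P.x$ in increasing left-to-right order. If $\mathcal{T}$ is a single node, $\mathsf{Alt}_\mathcal{T}(P)=0$. Otherwise, with left/right subtrees $\mathcal{T}_L,\mathcal{T}_R$ of the root, let $P_L=\{p\in P: p.x \text{ labels a leaf of } \mathcal{T}_L\}$, $P_R$ analogously, and $\mathsf{Alt}_\mathcal{T}(P)=\mathrm{mixValue}(P_L.y,P_R.y)+\mathsf{Alt}_{\mathcal{T}_L}(P_L)+\mathsf{Alt}_{\mathcal{T}_R}(P_R)$.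 Set $\mathsf{Alt}_\mathcal{T}(X)=\mathsf{Alt}_\mathcal{T}(G_X)$. Funnel bound: for points $p,q$, $\mathrm{rect}(p,q)=[\min(p.x,q.x),\max(p.x,q.x)]\times[\min(p.y,q.y),\max(p.y,q.y)]$. For $p\in P$, the left funnel $F_L(P,p)$ is the set of $q\in P$ with $q.y<p.y$, $q.x<p.x$ and $P\cap\mathrm{rect}(p,q)=\{p,q\}$; the right funnel $F_R(P,p)$ is defined the same way with $q.x>p.x$. Let $f(P,p)=\mathrm{mixValue}(F_L(P,p).y,F_R(P,p).y)$ and $\mathsf{Funnel}(P)=\sum_{p\in P}f(P,p)$; $\mathsf{Funnel}(X)=\mathsf{Funnel}(G_X)$. -}

module Defs where

open import Data.Nat using (ℕ; zero; suc; _+_; _<_; _≤_; _⊔_; _⊓_; _<?_; _≤?_)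
open import Data.Nat.Properties using (≤-decTotalOrder; <-strictTotalOrder)
import Data.Nat.Properties as ℕP
open import Data.Product using (_×_; _,_; proj₁; proj₂)
open import Data.Product.Properties using (≡-dec)
open import Data.Sum using (_⊎_)
open import Data.List using (List; []; _∷_; map; filter; _++_; length; zip; upTo)
open import Data.Nat.ListAction using (sum)
open import Data.List.Membership.DecPropositional ℕP._≟_ using (_∈?_)
open import Data.List.Relation.Unary.All using (All; all?)
open import Data.List.Relation.Binary.Permutation.Propositional using (_↭_)
open import Data.List.Sort ≤-decTotalOrder using (sort)
open import Data.List.Relation.Unary.Linked using (Linked)
open import Relation.Nullary using (¬_; Dec; yes; no; does)
open import Relation.Nullary.Decidable using (_×-dec_; _⊎-dec_; ¬?)
open import Relation.Binary.PropositionalEquality using (_≡_)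
open import Data.Bool using (if_then_else_)

data Letter : Set where
  𝙻 𝚁 : Letter

_≟L_ : (a b : Letter) → Dec (a ≡ b)
𝙻 ≟L 𝙻 = yes _≡_.refl
𝙻 ≟L 𝚁 = no (λ ())
𝚁 ≟L 𝙻 = no (λ ())
𝚁 ≟L 𝚁 = yes _≡_.refl

changes : Letter → List Letter → ℕ
changes a []      = 0
changes a (b ∷ s) = (if does (a ≟L b) then 0 else 1) + changes b s

blocks : List Letter → ℕ
blocks []      = 0
blocks (a ∷ s) = suc (changes a s)

-- mix(L,R): list L ∪ R increasingly, 𝙻 for elements of L, 𝚁 for elements of R
-- (meaningful for disjoint L, R)
mix : List ℕ → List ℕ → List Letter
mix L R = map (λ v → if does (v ∈? L) then 𝙻 else 𝚁) (sort (L ++ R))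

mixValue : List ℕ → List ℕ → ℕ
mixValue L R = blocks (mix L R)

Point : Set
Point = ℕ × ℕ

px py : Point → ℕ
px = proj₁
py = proj₂

G : List ℕ → List Point
G X = zip X (map suc (upTo (length X)))

data RefTree : Set where
  leaf : ℕ → RefTree
  node : RefTree → RefTree → RefTree

leaves : RefTree → List ℕ
leaves (leaf a)   = a ∷ []
leaves (node l r) = leaves l ++ leaves r

IsRefTree : RefTree → List Point → Set
IsRefTree T P = Linked _<_ (leaves T) × (leaves T ↭ map px P)

Alt : RefTree → List Point → ℕ
Alt (leaf _)   P = 0
Alt (node l r) P = mixValue (map py PL) (map py PR) + Alt l PL + Alt r PR
  where
  PL = filter (λ p → px p ∈? leaves l) P
  PR = filter (λ p → px p ∈? leaves r) P

InRect : Point → Point → Point → Set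
InRect p q r = ((px p ⊓ px q) ≤ px r × px r ≤ (px p ⊔ px q))
             × ((py p ⊓ py q) ≤ py r × py r ≤ (py p ⊔ py q))

inRect? : ∀ p q r → Dec (InRect p q r)
inRect? p q r = (((px p ⊓ px q) ≤? px r) ×-dec (px r ≤? (px p ⊔ px q)))
          ×-dec (((py p ⊓ py q) ≤? py r) ×-dec (py r ≤? (py p ⊔ py q)))

_≟P_ : (p q : Point) → Dec (p ≡ q)
_≟P_ = ≡-dec ℕP._≟_ ℕP._≟_

-- P ∩ rect(p,q) ⊆ {p,q}  (for p,q ∈ P this says P ∩ rect(p,q) = {p,q})
RectEmpty : List Point → Point → Point → Set
RectEmpty P p q = All (λ r → r ≡ p ⊎ (r ≡ q ⊎ ¬ InRect p q r)) P

rectEmpty? : ∀ P p q → Dec (RectEmpty P p q)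
rectEmpty? P p q = all? (λ r → (r ≟P p) ⊎-dec ((r ≟P q) ⊎-dec ¬? (inRect? p q r))) P

FL : List Point → Point → List Point
FL P p = filter (λ q → (py q <? py p) ×-dec ((px q <? px p) ×-dec rectEmpty? P p q)) P

FR : List Point → Point → List Point
FR P p = filter (λ q → (py q <? py p) ×-dec ((px p <? px q) ×-dec rectEmpty? P p q)) P

f : List Point → Point → ℕ
f P p = mixValue (map py (FL P p)) (map py (FR P p))

Funnel : List Point → ℕ
Funnel P = sum (map (f P) P)

{-# OPTIONS --safe #-}
module Submission where

-- At a node of the tree cut the points by a vertical line, and in each maximal run of right points
-- (other than the first and the last) take the leftmost point z.  If some right points nearer to the
-- line lie above z and some lie below it, z is on the side of an empty rectangle crossing the line,
-- with a point on each of its four sides, which shows up as one alternation in the funnel of its top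
-- point; funnel alternations determine the rectangle, and its vertical sides determine the node.
-- Otherwise nothing above (or nothing below) z in the right subtree is to the left of z, but
-- something in the whole node is; a point loses this property at most once on its way to the root.
-- Hence the alternations at all nodes number at most 2 (Funnel + 2m) + 3m.

open import Defs
open import Data.Nat using (ℕ; suc; _+_; _*_; _≤_; _<_; z≤n; s≤s; _<?_)
open import Data.Nat.Properties
open import Data.Nat.ListAction using (sum)
open import Data.Nat.Tactic.RingSolver using (solve-∀)
open import Data.Bool using (if_then_else_)
open import Data.Empty using (⊥-elim)
open import Data.Product using (Σ; ∃; _×_; _,_; proj₁; proj₂)
open import Data.Sum using (_⊎_; inj₁; inj₂; [_,_]′)
open import Data.List using (List; []; _∷_; map; filter; _++_; length; zip; upTo; concatMap)
open import Data.List.Properties using (map-++; map-∘; map-cong-local; filter-all; length-++; length-map; length-zipWith)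
open import Data.List.Membership.Propositional using (_∈_; _∉_)
open import Data.List.Membership.Propositional.Properties using (∈-++⁺ˡ; ∈-++⁺ʳ; ∈-++⁻; ∈-map⁺; ∈-map⁻; ∈-filter⁺; ∈-filter⁻; ∈-∃++; ∈-concatMap⁺)
open import Data.List.Membership.DecPropositional _≟_ using (_∈?_)
open import Data.List.Relation.Unary.Any using (here; there)
import Data.List.Relation.Unary.Any as Any
open import Data.List.Relation.Unary.All using (All; []; _∷_)
import Data.List.Relation.Unary.All as All
import Data.List.Relation.Unary.All.Properties as All
open import Data.List.Relation.Unary.AllPairs using (AllPairs; []; _∷_)
import Data.List.Relation.Unary.AllPairs as AllPairs
import Data.List.Relation.Unary.AllPairs.Properties as AllPairs
import Data.List.Relation.Unary.Linked.Properties as Linked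
open import Data.List.Relation.Unary.Unique.Propositional using (Unique)
import Data.List.Relation.Unary.Unique.Propositional.Properties as Unique
open import Data.List.Relation.Unary.Sorted.TotalOrder.Properties using (↗↭↗⇒≋)
open import Data.List.Relation.Binary.Pointwise using (Pointwise-≡⇒≡)
open import Data.List.Relation.Binary.Permutation.Propositional using (_↭_; ↭-refl; ↭-trans; ↭-reflexive; ↭-sym; prep; ↭⇒↭ₛ)
open import Data.List.Relation.Binary.Permutation.Propositional.Properties using (shift; map⁺; ↭-length; ∈-resp-↭)
open import Data.List.Sort ≤-decTotalOrder using (sort; sort-↭; sort-↗)
open import Function using (_∘_)
open import Function.Bundles using (mk⇔)
open import Relation.Binary using (tri<; tri≈; tri>; Total; Transitive)
open import Relation.Binary.PropositionalEquality using (_≡_; _≢_; refl; sym; trans; cong; cong₂; subst; subst₂)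
open import Relation.Nullary using (¬_; yes; no; does; contradiction)
open import Relation.Nullary.Decidable using (_×-dec_; _⊎-dec_; does-⇔)
open import Relation.Unary using (Decidable)

-- Counting and extrema in finite lists.

length-injection : {A B : Set} (g : A → B) {xs : List A} {ys : List B} → Unique xs →
  (∀ {x} → x ∈ xs → g x ∈ ys) →
  (∀ {x y} → x ∈ xs → y ∈ xs → g x ≡ g y → x ≡ y) →
  length xs ≤ length ys
length-injection g {[]} [] into inj = z≤n
length-injection g {x ∷ xs} (x∉ ∷ u) into inj with ∈-∃++ (into (here refl))
... | as , bs , refl = ≤-trans
  (s≤s (length-injection g u into′ (λ p q → inj (there p) (there q))))
  (≤-reflexive (sym (↭-length (shift (g x) as bs))))
  where
  into′ : ∀ {y} → y ∈ xs → g y ∈ as ++ bs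
  into′ y∈ with ∈-++⁻ as (into (there y∈))
  ... | inj₁ ∈as = ∈-++⁺ˡ ∈as
  ... | inj₂ (there ∈bs) = ∈-++⁺ʳ as ∈bs
  ... | inj₂ (here gy≡gx) =
    contradiction (inj (here refl) (there y∈) (sym gy≡gx)) (All.lookup x∉ y∈)

-- Each `b` determines its `x`, so witnesses chosen for distinct elements are distinct.
unique-choice : {A B : Set} {R : A → B → Set} {xs : List A} → Unique xs →
  (∀ {x y b} → R x b → R y b → x ≡ y) → All (λ x → ∃ (R x)) xs →
  Σ (List B) λ bs → Unique bs × All (λ b → ∃ λ x → x ∈ xs × R x b) bs × length bs ≡ length xs
unique-choice [] inj [] = [] , [] , [] , refl
unique-choice {xs = x ∷ xs} (x∉ ∷ u) inj ((b , r) ∷ rs)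
  with bs , ubs , abs , len ← unique-choice u inj rs =
  b ∷ bs , All.map fresh abs ∷ ubs ,
  (x , here refl , r) ∷ All.map (λ (y , y∈ , ry) → y , there y∈ , ry) abs ,
  cong suc len
  where
  fresh : ∀ {b′} → (∃ λ y → y ∈ xs × _) → b ≢ b′
  fresh (y , y∈ , ry) refl = All.lookup x∉ y∈ (inj r ry)

extremum : {A : Set} {P : A → Set} (P? : Decidable P) {_≲_ : A → A → Set} →
  Total _≲_ → Transitive _≲_ → (xs : List A) →
  (∀ {x} → x ∈ xs → ¬ P x) ⊎ (∃ λ m → m ∈ xs × P m × (∀ {x} → x ∈ xs → P x → m ≲ x))
extremum P? total tr [] = inj₁ λ ()
extremum {P = P} P? {_≲_} total tr (x ∷ xs) with P? x | extremum P? total tr xs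
... | no ¬px | inj₁ none = inj₁ λ { (here refl) → ¬px ; (there y∈) → none y∈ }
... | no ¬px | inj₂ (m , m∈ , pm , min) =
  inj₂ (m , there m∈ , pm , λ { (here refl) px → contradiction px ¬px ; (there y∈) → min y∈ })
... | yes px | inj₁ none =
  inj₂ (x , here refl , px ,
    λ { (here refl) _ → [ (λ e → e) , (λ e → e) ]′ (total x x)
      ; (there y∈) qy → contradiction qy (none y∈) })
... | yes px | inj₂ (m , m∈ , pm , min) with total x m
...   | inj₁ x≲m = inj₂ (x , here refl , px ,
    λ { (here refl) _ → [ (λ e → e) , (λ e → e) ]′ (total x x)
      ; (there y∈) qy → tr x≲m (min y∈ qy) })
...   | inj₂ m≲x = inj₂ (m , there m∈ , pm , λ { (here refl) _ → m≲x ; (there y∈) → min y∈ })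

module _ {A : Set} (key : A → ℕ) {P : A → Set} (P? : Decidable P) (xs : List A) where

  argmin : (∀ {x} → x ∈ xs → ¬ P x) ⊎ (∃ λ m → m ∈ xs × P m × (∀ {x} → x ∈ xs → P x → key m ≤ key x))
  argmin = extremum P? (λ x y → ≤-total (key x) (key y)) ≤-trans xs

  argmax : (∀ {x} → x ∈ xs → ¬ P x) ⊎ (∃ λ m → m ∈ xs × P m × (∀ {x} → x ∈ xs → P x → key x ≤ key m))
  argmax = extremum P? (λ x y → ≤-total (key y) (key x)) (λ a b → ≤-trans b a) xs

-- Points listed by height, and mixing words as letters of points.

_below_ : Point → Point → Set
p below q = py p < py q

-- Records at once that heights are distinct and that the list is ordered by height; `filter`
-- preserves both.
Ascending : List Point → Set
Ascending = AllPairs _below_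

ascending-py-injective : ∀ {S q r} → Ascending S → q ∈ S → r ∈ S → py q ≡ py r → q ≡ r
ascending-py-injective (_ ∷ _)  (here refl) (here refl) _ = refl
ascending-py-injective (a ∷ _)  (here refl) (there r∈) e = contradiction e (<⇒≢ (All.lookup a r∈))
ascending-py-injective (a ∷ _)  (there q∈) (here refl) e = contradiction (sym e) (<⇒≢ (All.lookup a q∈))
ascending-py-injective (_ ∷ as) (there q∈) (there r∈) e = ascending-py-injective as q∈ r∈ e

letter : {A : Point → Set} → Decidable A → Point → Letter
letter A? q = if does (A? q) then 𝙻 else 𝚁

letter-𝙻 : ∀ {A : Point → Set} (A? : Decidable A) {q} → A q → letter A? q ≡ 𝙻
letter-𝙻 A? {q} a with A? q
... | yes _ = refl
... | no ¬a = contradiction a ¬a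

letter-𝚁 : ∀ {A : Point → Set} (A? : Decidable A) {q} → ¬ A q → letter A? q ≡ 𝚁
letter-𝚁 A? {q} ¬a with A? q
... | yes a = contradiction a ¬a
... | no _ = refl

module _ {A B : Point → Set} (A? : Decidable A) (B? : Decidable B)
         (disjoint : ∀ {q} → A q → ¬ B q) where

  A∪B? : Decidable (λ q → A q ⊎ B q)
  A∪B? q = A? q ⊎-dec B? q

  filter-∪-↭ : ∀ S → filter A? S ++ filter B? S ↭ filter A∪B? S
  filter-∪-↭ [] = ↭-refl
  filter-∪-↭ (x ∷ S) with A? x | B? x
  ... | yes a | yes b = contradiction b (disjoint a)
  ... | yes a | no _  = prep x (filter-∪-↭ S)
  ... | no _  | yes _ = ↭-trans (shift x (filter A? S) (filter B? S)) (prep x (filter-∪-↭ S))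
  ... | no _  | no _  = filter-∪-↭ S

  -- Filtering an ascending list leaves the heights sorted, so `sort` has to return them in this
  -- order; and since heights are distinct, looking up a height among the left heights amounts to
  -- testing the point itself.
  mix-filter : ∀ {S} → Ascending S →
    mix (map py (filter A? S)) (map py (filter B? S)) ≡ map (letter A?) (filter A∪B? S)
  mix-filter {S} asc = trans (cong (map isL) sorted) (trans (sym (map-∘ W)) (map-cong-local (All.tabulate same)))
    where
    W = filter A∪B? S
    isL : ℕ → Letter
    isL v = if does (v ∈? map py (filter A? S)) then 𝙻 else 𝚁
    perm : sort (map py (filter A? S) ++ map py (filter B? S)) ↭ map py W
    perm = ↭-trans (sort-↭ _)
      (↭-trans (↭-reflexive (sym (map-++ py (filter A? S) (filter B? S))))
               (map⁺ py (filter-∪-↭ S)))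
    sorted : sort (map py (filter A? S) ++ map py (filter B? S)) ≡ map py W
    sorted = Pointwise-≡⇒≡ (↗↭↗⇒≋ ≤-totalOrder (sort-↗ _)
      (Linked.AllPairs⇒Linked (AllPairs.map⁺ (AllPairs.map <⇒≤ (AllPairs.filter⁺ A∪B? asc))))
      (↭⇒↭ₛ perm))
    same : ∀ {q} → q ∈ W → isL (py q) ≡ letter A? q
    same {q} q∈W = cong (if_then 𝙻 else 𝚁) (does-⇔ (mk⇔ to from) (py q ∈? _) (A? q))
      where
      q∈S = proj₁ (∈-filter⁻ A∪B? {xs = S} q∈W)
      from : A q → py q ∈ map py (filter A? S)
      from a = ∈-map⁺ py (∈-filter⁺ A? q∈S a)
      to : py q ∈ map py (filter A? S) → A q
      to y∈ with r , r∈ , e ← ∈-map⁻ py y∈ with r∈S , a ← ∈-filter⁻ A? {xs = S} r∈ =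
        subst A (sym (ascending-py-injective asc q∈S r∈S e)) a

-- Empty rectangles and charges.

-- Horizontal order seen from the left (𝙻), or from the right after reflection (𝚁).
_≺[_]_ : ℕ → Letter → ℕ → Set
x ≺[ 𝙻 ] y = x < y
x ≺[ 𝚁 ] y = y < x

≺-trans : ∀ s {x y z} → x ≺[ s ] y → y ≺[ s ] z → x ≺[ s ] z
≺-trans 𝙻 a b = <-trans a b
≺-trans 𝚁 a b = <-trans b a

≺-tri : ∀ s x y → x ≺[ s ] y ⊎ (x ≡ y ⊎ y ≺[ s ] x)
≺-tri s x y with <-cmp x y
≺-tri 𝙻 x y | tri< a _ _ = inj₁ a
≺-tri 𝙻 x y | tri≈ _ e _ = inj₂ (inj₁ e)
≺-tri 𝙻 x y | tri> _ _ c = inj₂ (inj₂ c)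
≺-tri 𝚁 x y | tri< a _ _ = inj₂ (inj₂ a)
≺-tri 𝚁 x y | tri≈ _ e _ = inj₂ (inj₁ e)
≺-tri 𝚁 x y | tri> _ _ c = inj₁ c

opposite : Letter → Letter
opposite 𝙻 = 𝚁
opposite 𝚁 = 𝙻

≺-flip : ∀ s {x y} → x ≺[ s ] y → y ≺[ opposite s ] x
≺-flip 𝙻 lt = lt
≺-flip 𝚁 lt = lt

≺-unflip : ∀ s {x y} → x ≺[ opposite s ] y → y ≺[ s ] x
≺-unflip 𝙻 lt = lt
≺-unflip 𝚁 lt = lt

-- For s = 𝙻: an empty open rectangle whose left, right, top and bottom sides carry a, b, p and d,
-- with a above b and d to the left of p.  In the funnel of p, b is then the start of a block
-- preceded by d, and a is the start of the next block.
record ZRect (s : Letter) (Q : List Point) (p a b : Point) : Set where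
  field
    d : Point
    p∈ : p ∈ Q
    a∈ : a ∈ Q
    b∈ : b ∈ Q
    d∈ : d ∈ Q
    d<b : py d < py b
    b<a : py b < py a
    a<p : py a < py p
    a≺d : px a ≺[ s ] px d
    d≺p : px d ≺[ s ] px p
    p≺b : px p ≺[ s ] px b
    empty : ∀ {q} → q ∈ Q → py d < py q → py q < py p → px a ≺[ s ] px q → ¬ (px q ≺[ s ] px b)

-- The orientation `s` and the bottom point `d` of a rectangle are only asserted to exist, in
-- `Valid`, so that equality of charges depends on `p`, `a`, `b` alone.
data Charge : Set where
  rect : (p a b : Point) → Charge
  up down : Point → Charge

Valid : List Point → Charge → Set
Valid Q (rect p a b) = ∃ λ s → ZRect s Q p a b
Valid Q (up z)   = z ∈ Q × ∃ λ q → q ∈ Q × py z < py q × px q < px z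
Valid Q (down z) = z ∈ Q × ∃ λ q → q ∈ Q × py q < py z × px q < px z

-- A point of `Q` inside the open rectangle lies horizontally between `a` and `b`, so by convexity
-- it is already in `Q′`, where the rectangle is empty. For `up` and `down` the old witness serves.
-- Thus a charge valid at a node stays valid at all its ancestors, and cannot be new at any of them.
Valid-mono : ∀ {Q Q′} → (∀ {q} → q ∈ Q′ → q ∈ Q) →
  (∀ {q a b} → q ∈ Q → a ∈ Q′ → b ∈ Q′ → px a < px q → px q < px b → q ∈ Q′) →
  ∀ {c} → Valid Q′ c → Valid Q c
Valid-mono {Q} {Q′} sub convex {rect p a b} (s , z) = s , record
  { d = d ; p∈ = sub p∈ ; a∈ = sub a∈ ; b∈ = sub b∈ ; d∈ = sub d∈
  ; d<b = d<b ; b<a = b<a ; a<p = a<p ; a≺d = a≺d ; d≺p = d≺p ; p≺b = p≺b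
  ; empty = λ q∈ y₁ y₂ x₁ x₂ → empty (between s q∈ x₁ x₂) y₁ y₂ x₁ x₂ }
  where
  open ZRect z
  between : ∀ s {q} → q ∈ Q → px a ≺[ s ] px q → px q ≺[ s ] px b → q ∈ Q′
  between 𝙻 q∈ x₁ x₂ = convex q∈ a∈ b∈ x₁ x₂
  between 𝚁 q∈ x₁ x₂ = convex q∈ b∈ a∈ x₂ x₁
Valid-mono sub convex {up z}   (z∈ , q , q∈ , y , x) = sub z∈ , q , sub q∈ , y , x
Valid-mono sub convex {down z} (z∈ , q , q∈ , y , x) = sub z∈ , q , sub q∈ , y , x

px-Injective : List Point → Set
px-Injective Q = ∀ {q r} → q ∈ Q → r ∈ Q → px q ≡ px r → q ≡ r

-- One vertical cut: a key from every inner run of right points.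

module Split {A B : Point → Set} (A? : Decidable A) (B? : Decidable B)
  (separated : ∀ {q r} → A q → B r → px q < px r)
  {Q : List Point} (asc : Ascending Q) (px-inj : px-Injective Q)
  (cover : ∀ {q} → q ∈ Q → A q ⊎ B q) where

  disjoint : ∀ {q} → A q → ¬ B q
  disjoint a b = <-irrefl refl (separated a b)

  QL QR : List Point
  QL = filter A? Q
  QR = filter B? Q

  word : List Point → List Letter
  word = map (letter A?)

  -- z is nearest to the cut within its maximal run of right points, and this run
  -- lies between the left points lo and hi.
  record Key (z : Point) : Set where
    field
      lo hi : Point
      z∈ : z ∈ Q
      lo∈ : lo ∈ Q
      hi∈ : hi ∈ Q
      Bz : B z
      Alo : A lo
      Ahi : A hi
      lo<z : py lo < py z
      z<hi : py z < py hi
      gap : ∀ {q} → q ∈ Q → B q → px q < px z → py q < py lo ⊎ py hi < py q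

  below-all : Point → List Point → Set
  below-all q = All (q below_)

  mutual
    -- The points are read upwards in two states; in this one the last point read is the left point
    -- `lo`. The summand 1 pays for the change into the next right run. Each key pays for the change
    -- that ends its own run and for the change into the run after it, if there is one.
    keys-after-𝙻 : ∀ rest {lo} → lo ∈ Q → A lo → (∀ {q} → q ∈ rest → q ∈ Q) →
      Ascending rest → below-all lo rest →
      (∀ {q} → q ∈ Q → B q → py q < py lo ⊎ q ∈ rest) →
      Σ (List Point) λ zs → All Key zs × below-all lo zs × Ascending zs ×
        changes 𝙻 (word rest) ≤ 1 + 2 * length zs
    keys-after-𝙻 [] _ _ _ _ _ _ = [] , [] , [] , [] , z≤n
    keys-after-𝙻 (x ∷ rest) {lo} lo∈ Alo sub (x< ∷ as) (lo<x ∷ lo<) cov with A? x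
    ... | yes Ax =
        let zs , ks , ab , az , le = keys-after-𝙻 rest (sub (here refl)) Ax (λ m → sub (there m)) as x< cov′ in
        zs , ks , All.map (<-trans lo<x) ab , az , le
      where
      cov′ : ∀ {q} → q ∈ Q → B q → py q < py x ⊎ q ∈ rest
      cov′ q∈ Bq with cov q∈ Bq
      ... | inj₁ lt = inj₁ (<-trans lt lo<x)
      ... | inj₂ (here refl) = contradiction Bq (disjoint Ax)
      ... | inj₂ (there m) = inj₂ m
    ... | no ¬Ax =
        let zs , ks , ab , az , le = keys-in-𝚁 rest lo∈ Alo x∈ Bx lo<x (λ m → sub (there m)) as x< cov′ in
        zs , ks , ab , az , s≤s le
      where
      x∈ = sub (here refl)
      Bx : B x
      Bx = [ (λ a → contradiction a ¬Ax) , (λ b → b) ]′ (cover x∈)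
      cov′ : ∀ {q} → q ∈ Q → B q → py q < py lo ⊎ ((px x ≤ px q × below-all q rest) ⊎ q ∈ rest)
      cov′ q∈ Bq with cov q∈ Bq
      ... | inj₁ lt = inj₁ lt
      ... | inj₂ (here refl) = inj₂ (inj₁ (≤-refl , x<))
      ... | inj₂ (there m) = inj₂ (inj₂ m)

    -- Here `lo` is the left point just below the current right run and `z` is the leftmost point of
    -- the run so far. The last hypothesis is the invariant behind `gap`: a right point is below
    -- `lo`, or already read and not left of `z`, or unread. A run that no left point closes yields
    -- no key.
    keys-in-𝚁 : ∀ rest {lo z} → lo ∈ Q → A lo → z ∈ Q → B z → py lo < py z →
      (∀ {q} → q ∈ rest → q ∈ Q) → Ascending rest → below-all z rest →
      (∀ {q} → q ∈ Q → B q → py q < py lo ⊎ ((px z ≤ px q × below-all q rest) ⊎ q ∈ rest)) →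
      Σ (List Point) λ zs → All Key zs × below-all lo zs × Ascending zs ×
        changes 𝚁 (word rest) ≤ 2 * length zs
    keys-in-𝚁 [] _ _ _ _ _ _ _ _ _ = [] , [] , [] , [] , z≤n
    keys-in-𝚁 (x ∷ rest) {lo} {z} lo∈ Alo z∈ Bz lo<z sub (x< ∷ as) (z<x ∷ z<) cov with A? x
    ... | yes Ax =
        let zs , ks , ab , az , le = keys-after-𝙻 rest (sub (here refl)) Ax (λ m → sub (there m)) as x< cov′ in
        -- The left point `x` closes the run, so `z` is final and becomes a key with `hi = x`.
        z ∷ zs , key ∷ ks , lo<z ∷ All.map (<-trans (<-trans lo<z z<x)) ab ,
        All.map (<-trans z<x) ab ∷ az ,
        ≤-trans (s≤s le) (≤-reflexive (sym (*-suc 2 (length zs))))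
      where
      cov′ : ∀ {q} → q ∈ Q → B q → py q < py x ⊎ q ∈ rest
      cov′ q∈ Bq with cov q∈ Bq
      ... | inj₁ lt = inj₁ (<-trans lt (<-trans lo<z z<x))
      ... | inj₂ (inj₁ (_ , q<x ∷ _)) = inj₁ q<x
      ... | inj₂ (inj₂ (here refl)) = contradiction Bq (disjoint Ax)
      ... | inj₂ (inj₂ (there m)) = inj₂ m
      key : Key z
      key = record
        { z∈ = z∈ ; lo∈ = lo∈ ; hi∈ = sub (here refl) ; Bz = Bz ; Alo = Alo ; Ahi = Ax
        ; lo<z = lo<z ; z<hi = z<x ; gap = gap }
        where
        gap : ∀ {q} → q ∈ Q → B q → px q < px z → py q < py lo ⊎ py x < py q
        gap q∈ Bq lt with cov q∈ Bq
        ... | inj₁ q<lo = inj₁ q<lo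
        ... | inj₂ (inj₁ (ge , _)) = contradiction lt (≤⇒≯ ge)
        ... | inj₂ (inj₂ (here refl)) = contradiction Bq (disjoint Ax)
        ... | inj₂ (inj₂ (there m)) = inj₂ (All.lookup x< m)
    ... | no ¬Ax with px x <? px z
    ...   | yes x<z = keys-in-𝚁 rest lo∈ Alo x∈ Bx (<-trans lo<z z<x) (λ m → sub (there m)) as x< cov′
      where
      x∈ = sub (here refl)
      Bx : B x
      Bx = [ (λ a → contradiction a ¬Ax) , (λ b → b) ]′ (cover x∈)
      cov′ : ∀ {q} → q ∈ Q → B q → py q < py lo ⊎ ((px x ≤ px q × below-all q rest) ⊎ q ∈ rest)
      cov′ q∈ Bq with cov q∈ Bq
      ... | inj₁ lt = inj₁ lt
      ... | inj₂ (inj₁ (ge , _ ∷ q<)) = inj₂ (inj₁ (≤-trans (<⇒≤ x<z) ge , q<))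
      ... | inj₂ (inj₂ (here refl)) = inj₂ (inj₁ (≤-refl , x<))
      ... | inj₂ (inj₂ (there m)) = inj₂ (inj₂ m)
    ...   | no x≮z = keys-in-𝚁 rest lo∈ Alo z∈ Bz lo<z (λ m → sub (there m)) as z< cov′
      where
      cov′ : ∀ {q} → q ∈ Q → B q → py q < py lo ⊎ ((px z ≤ px q × below-all q rest) ⊎ q ∈ rest)
      cov′ q∈ Bq with cov q∈ Bq
      ... | inj₁ lt = inj₁ lt
      ... | inj₂ (inj₁ (ge , _ ∷ q<)) = inj₂ (inj₁ (ge , q<))
      ... | inj₂ (inj₂ (here refl)) = inj₂ (inj₁ (≮⇒≥ x≮z , x<))
      ... | inj₂ (inj₂ (there m)) = inj₂ (inj₂ m)

  -- An initial right run has no left point below it and is skipped. Of the constant 2, one pays for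
  -- the change to the first left point, the other is the summand 1 of `keys-after-𝙻`.
  keys-after-initial-𝚁 : ∀ rest → (∀ {q} → q ∈ rest → q ∈ Q) → Ascending rest →
    (∀ {q} → q ∈ Q → B q → below-all q rest ⊎ q ∈ rest) →
    Σ (List Point) λ zs → All Key zs × Ascending zs × changes 𝚁 (word rest) ≤ 2 + 2 * length zs
  keys-after-initial-𝚁 [] _ _ _ = [] , [] , [] , z≤n
  keys-after-initial-𝚁 (x ∷ rest) sub (x< ∷ as) cov with A? x
  ... | yes Ax =
      let zs , ks , _ , az , le = keys-after-𝙻 rest (sub (here refl)) Ax (λ m → sub (there m)) as x< cov′ in
      zs , ks , az , s≤s le
    where
    cov′ : ∀ {q} → q ∈ Q → B q → py q < py x ⊎ q ∈ rest
    cov′ q∈ Bq with cov q∈ Bq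
    ... | inj₁ (q<x ∷ _) = inj₁ q<x
    ... | inj₂ (here refl) = contradiction Bq (disjoint Ax)
    ... | inj₂ (there m) = inj₂ m
  ... | no _ = keys-after-initial-𝚁 rest (λ m → sub (there m)) as cov′
    where
    cov′ : ∀ {q} → q ∈ Q → B q → below-all q rest ⊎ q ∈ rest
    cov′ q∈ Bq with cov q∈ Bq
    ... | inj₁ (_ ∷ q<) = inj₁ q<
    ... | inj₂ (here refl) = inj₁ x<
    ... | inj₂ (there m) = inj₂ m

  keys : Σ (List Point) λ zs → All Key zs × Ascending zs × blocks (word Q) ≤ 3 + 2 * length zs
  keys =
    let zs , ks , az , le = keys-after-initial-𝚁 Q (λ m → m) asc (λ q∈ _ → inj₂ q∈) in
    zs , ks , az , ≤-trans (blocks≤ (word Q)) (s≤s le)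
    where
    -- Starting as if after an `𝚁` can only add a change; the further 1 passes from changes to
    -- blocks and makes the constant 3.
    blocks≤ : ∀ W → blocks W ≤ 1 + changes 𝚁 W
    blocks≤ [] = z≤n
    blocks≤ (𝙻 ∷ W) = s≤s (n≤1+n _)
    blocks≤ (𝚁 ∷ W) = ≤-refl

  -- Charges that become valid at the cut.

  ∉QL : ∀ {w} → B w → w ∉ QL
  ∉QL Bw w∈ = disjoint (proj₂ (∈-filter⁻ A? {xs = Q} w∈)) Bw

  ∉QR : ∀ {w} → A w → w ∉ QR
  ∉QR Aw w∈ = disjoint Aw (proj₂ (∈-filter⁻ B? {xs = Q} w∈))

  -- A rectangle belongs to whichever of its vertical sides is right of the cut. Requiring the other
  -- side to be on the left is what lets `crossing-injective` recover the owner.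
  Owner : Point → Charge → Set
  Owner z (rect p a b) = (b ≡ z × A a) ⊎ (a ≡ z × A b)
  Owner z (up w)   = w ≡ z
  Owner z (down w) = w ≡ z

  Crossing : Point → Charge → Set
  Crossing z c = B z × Owner z c × Valid Q c × ¬ Valid QL c × ¬ Valid QR c

  crossing-injective : ∀ {z z′ c} → Crossing z c → Crossing z′ c → z ≡ z′
  crossing-injective {c = rect p a b} (_ , inj₁ (refl , _) , _) (_ , inj₁ (refl , _) , _) = refl
  crossing-injective {c = rect p a b} (Bz , inj₁ (refl , _) , _) (_ , inj₂ (refl , Ab) , _) = contradiction Bz (disjoint Ab)
  crossing-injective {c = rect p a b} (Bz , inj₂ (refl , _) , _) (_ , inj₁ (refl , Aa) , _) = contradiction Bz (disjoint Aa)
  crossing-injective {c = rect p a b} (_ , inj₂ (refl , _) , _) (_ , inj₂ (refl , _) , _) = refl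
  crossing-injective {c = up w}   (_ , refl , _) (_ , refl , _) = refl
  crossing-injective {c = down w} (_ , refl , _) (_ , refl , _) = refl

  module _ {z : Point} (key : Key z) where
    open Key key

    -- The point `hi`, left of the cut and above `z`, makes `up z` valid in `Q`. No such witness is
    -- left in `QR`, and `QL` does not contain `z`.
    crossing-up : (∀ {q} → q ∈ Q → ¬ (B q × (py z < py q × px q < px z))) → Crossing z (up z)
    crossing-up none = Bz , refl , (z∈ , hi , hi∈ , z<hi , separated Ahi Bz) , (λ v → ∉QL Bz (proj₁ v)) ,
      λ (_ , q , q∈ , y , x) → none (proj₁ (∈-filter⁻ B? {xs = Q} q∈)) (proj₂ (∈-filter⁻ B? {xs = Q} q∈) , y , x)

    crossing-down : (∀ {q} → q ∈ Q → ¬ (B q × (py q < py z × px q < px z))) → Crossing z (down z)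
    crossing-down none = Bz , refl , (z∈ , lo , lo∈ , lo<z , separated Alo Bz) , (λ v → ∉QL Bz (proj₁ v)) ,
      λ (_ , q , q∈ , y , x) → none (proj₁ (∈-filter⁻ B? {xs = Q} q∈)) (proj₂ (∈-filter⁻ B? {xs = Q} q∈) , y , x)

    module _ {t j : Point}
      (t∈ : t ∈ Q) (Bt : B t) (z<t : py z < py t) (t<z : px t < px z)
      (t-min : ∀ {q} → q ∈ Q → B q × (py z < py q × px q < px z) → py t ≤ py q)
      (j∈ : j ∈ Q) (Bj : B j) (j<z : py j < py z) (j<z′ : px j < px z)
      (j-max : ∀ {q} → q ∈ Q → B q × (py q < py z × px q < px z) → py q ≤ py j) where

      -- By extremality of `t` and `j`. Consequently only left points can obstruct a rectangle that
      -- has `z` as its right side and stays between these two heights.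
      no-right : ∀ {q} → q ∈ Q → B q → py j < py q → py q < py t → ¬ (px q < px z)
      no-right {q} q∈ Bq j<q q<t q<z with <-cmp (py q) (py z)
      ... | tri< lt _ _ = <⇒≱ j<q (j-max q∈ (Bq , lt , q<z))
      ... | tri≈ _ e _ = <⇒≢ q<z (cong px (ascending-py-injective asc q∈ z∈ e))
      ... | tri> _ _ gt = <⇒≱ q<t (t-min q∈ (Bq , gt , q<z))

      module _ {n m : Point}
        (n∈ : n ∈ Q) (An : A n) (z<n : py z < py n) (n<t : py n < py t)
        (n-max : ∀ {q} → q ∈ Q → A q × (py z < py q × py q < py t) → px q ≤ px n)
        (m∈ : m ∈ Q) (Am : A m) (j<m : py j < py m) (m<z : py m < py z)
        (m-max : ∀ {q} → q ∈ Q → A q × (py j < py q × py q < py z) → px q ≤ px m) where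

        -- The rectangle has left side `n`, right side `z` and top `t`. Its bottom `d` is the
        -- highest left point below `z` and right of `n`; as `m` is a candidate, `d` is above `j`. A
        -- left point inside would contradict the choice of `d` if below `z`, and that of `n` if
        -- above.
        lower-left-nearer : px n < px m → ∃ (Crossing z)
        lower-left-nearer n<m with argmax py (λ q → A? q ×-dec ((py q <? py z) ×-dec (px n <? px q))) Q
        ... | inj₁ none = contradiction (Am , m<z , n<m) (none m∈)
        ... | inj₂ (d , d∈ , (Ad , d<z , n<d) , d-max) =
          rect t n z , Bz , inj₁ (refl , An) , (𝙻 , zr) ,
          (λ (_ , r) → ∉QL Bz (ZRect.b∈ r)) , (λ (_ , r) → ∉QR An (ZRect.a∈ r))
          where
          j<d : py j < py d
          j<d = <-≤-trans j<m (d-max m∈ (Am , m<z , n<m))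
          empty : ∀ {q} → q ∈ Q → py d < py q → py q < py t → px n < px q → ¬ (px q < px z)
          empty {q} q∈ d<q q<t n<q q<z with cover q∈
          ... | inj₂ Bq = no-right q∈ Bq (<-trans j<d d<q) q<t q<z
          ... | inj₁ Aq with <-cmp (py q) (py z)
          ...   | tri< lt _ _ = <⇒≱ d<q (d-max q∈ (Aq , lt , n<q))
          ...   | tri≈ _ e _ = <⇒≢ q<z (cong px (ascending-py-injective asc q∈ z∈ e))
          ...   | tri> _ _ gt = <⇒≱ n<q (n-max q∈ (Aq , gt , q<t))
          zr : ZRect 𝙻 Q t n z
          zr = record
            { d = d ; p∈ = t∈ ; a∈ = n∈ ; b∈ = z∈ ; d∈ = d∈ ; d<b = d<z ; b<a = z<n ; a<p = n<t
            ; a≺d = n<d ; d≺p = separated Ad Bt ; p≺b = t<z ; empty = empty }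

        -- The same construction upside down: left side `m`, bottom `j`, and as top the lowest left
        -- point `p` above `z` and right of `m`. The higher vertical side is now `z`, whence the
        -- orientation `𝚁`.
        upper-left-nearer : px m < px n → ∃ (Crossing z)
        upper-left-nearer m<n with argmin py (λ q → A? q ×-dec ((py z <? py q) ×-dec (px m <? px q))) Q
        ... | inj₁ none = contradiction (An , z<n , m<n) (none n∈)
        ... | inj₂ (p , p∈ , (Ap , z<p , m<p) , p-min) =
          rect p z m , Bz , inj₂ (refl , Am) , (𝚁 , zr) ,
          (λ (_ , r) → ∉QL Bz (ZRect.a∈ r)) , (λ (_ , r) → ∉QR Am (ZRect.b∈ r))
          where
          p<t : py p < py t
          p<t = ≤-<-trans (p-min n∈ (An , z<n , m<n)) n<t
          empty : ∀ {q} → q ∈ Q → py j < py q → py q < py p → px q < px z → ¬ (px m < px q)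
          empty {q} q∈ j<q q<p q<z m<q with cover q∈
          ... | inj₂ Bq = no-right q∈ Bq j<q (<-trans q<p p<t) q<z
          ... | inj₁ Aq with <-cmp (py q) (py z)
          ...   | tri< lt _ _ = <⇒≱ m<q (m-max q∈ (Aq , j<q , lt))
          ...   | tri≈ _ e _ = <⇒≢ q<z (cong px (ascending-py-injective asc q∈ z∈ e))
          ...   | tri> _ _ gt = <⇒≱ q<p (p-min q∈ (Aq , gt , m<q))
          zr : ZRect 𝚁 Q p z m
          zr = record
            { d = j ; p∈ = p∈ ; a∈ = z∈ ; b∈ = m∈ ; d∈ = j∈ ; d<b = j<m ; b<a = m<z ; a<p = z<p
            ; a≺d = j<z′ ; d≺p = separated Ap Bj ; p≺b = m<p ; empty = empty }

    crossing : ∃ (Crossing z)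
    crossing with argmin py (λ q → B? q ×-dec ((py z <? py q) ×-dec (px q <? px z))) Q
    ... | inj₁ none = up z , crossing-up none
    ... | inj₂ (t , t∈ , (Bt , z<t , t<z) , t-min)
      with argmax py (λ q → B? q ×-dec ((py q <? py z) ×-dec (px q <? px z))) Q
    ... | inj₁ none = down z , crossing-down none
    ... | inj₂ (j , j∈ , (Bj , j<z , j<z′) , j-max)
      with argmax px (λ q → A? q ×-dec ((py z <? py q) ×-dec (py q <? py t))) Q
         | argmax px (λ q → A? q ×-dec ((py j <? py q) ×-dec (py q <? py z))) Q
    -- A right point left of `z` avoids the heights from `lo` to `hi` by `gap`. So `t`, being above
    -- `z`, is above `hi`, and `hi` is a candidate for `n`; likewise `lo` is one for `m`.
    ... | inj₁ none | _ = contradiction (Ahi , z<hi , hi<t) (none hi∈)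
      where
      hi<t : py hi < py t
      hi<t = [ (λ lt → contradiction (<-trans z<t lt) (<⇒≯ lo<z)) , (λ lt → lt) ]′ (gap t∈ Bt t<z)
    ... | inj₂ _ | inj₁ none = contradiction (Alo , j<lo , lo<z) (none lo∈)
      where
      j<lo : py j < py lo
      j<lo = [ (λ lt → lt) , (λ lt → contradiction (<-trans lt j<z) (<⇒≯ z<hi)) ]′ (gap j∈ Bj j<z′)
    ... | inj₂ (n , n∈ , (An , z<n , n<t) , n-max) | inj₂ (m , m∈ , (Am , j<m , m<z) , m-max)
      with <-cmp (px n) (px m)
    ... | tri< n<m _ _ = lower-left-nearer t∈ Bt z<t t<z t-min j∈ Bj j<z j<z′ j-max n∈ An z<n n<t n-max m∈ Am j<m m<z m-max n<m
    ... | tri≈ _ e _ = contradiction (cong py (px-inj n∈ m∈ e)) (>⇒≢ (<-trans m<z z<n))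
    ... | tri> _ _ m<n = upper-left-nearer t∈ Bt z<t t<z t-min j∈ Bj j<z j<z′ j-max n∈ An z<n n<t n-max m∈ Am j<m m<z m-max m<n

  mixValue-split : mixValue (map py QL) (map py QR) ≡ blocks (word Q)
  mixValue-split = cong blocks (trans (mix-filter A? B? disjoint asc)
    (cong word (filter-all (A∪B? A? B? disjoint) (All.tabulate cover))))

  -- Keys ascend strictly, hence are distinct, and a crossing charge determines its key; so there
  -- are as many charges as keys.
  crossing-charges : Σ (List Charge) λ cs → Unique cs ×
    All (λ c → Valid Q c × ¬ Valid QL c × ¬ Valid QR c) cs ×
    mixValue (map py QL) (map py QR) ≤ 3 + 2 * length cs
  crossing-charges with zs , ks , az , le ← keys
    with cs , u , cr , len ← unique-choice (AllPairs.map (λ lt e → <⇒≢ lt (cong py e)) az)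
           crossing-injective (All.map crossing ks) =
    cs , u , All.map (λ (_ , _ , _ , _ , v) → v) cr ,
    subst₂ (λ k n → k ≤ 3 + 2 * n) (sym mixValue-split) (sym len) le

-- Induction over the reference tree.

AllPairs-++⁻ : {A : Set} {R : A → A → Set} (xs : List A) {ys : List A} → AllPairs R (xs ++ ys) →
  AllPairs R xs × AllPairs R ys × (∀ {x y} → x ∈ xs → y ∈ ys → R x y)
AllPairs-++⁻ [] rs = [] , rs , λ ()
AllPairs-++⁻ (x ∷ xs) (r ∷ rs) with AllPairs-++⁻ xs rs
... | rxs , rys , across = All.++⁻ˡ xs r ∷ rxs , rys ,
  λ { (here refl) y∈ → All.lookup (All.++⁻ʳ xs r) y∈ ; (there x∈) y∈ → across x∈ y∈ }

-- Every inner node costs an additive 3, and there is one leaf more than inner nodes; the 3 on the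
-- left is this surplus, which makes the induction close.
charges : ∀ T {Q} → AllPairs _<_ (leaves T) → Ascending Q → px-Injective Q →
  (∀ {q} → q ∈ Q → px q ∈ leaves T) →
  Σ (List Charge) λ cs → Unique cs × All (Valid Q) cs ×
    3 + Alt T Q ≤ 2 * length cs + 3 * length (leaves T)
charges (leaf _) _ _ _ _ = [] , [] , [] , ≤-refl
charges (node l r) {Q} inc asc px-inj labels =
  let csˡ , uˡ , vˡ , leˡ = charges l incˡ (AllPairs.filter⁺ inL? asc)
        (λ q∈ r∈ → px-inj (QL⊆ q∈) (QL⊆ r∈)) (proj₂ ∘ ∈-filter⁻ inL? {xs = Q})
      csʳ , uʳ , vʳ , leʳ = charges r incʳ (AllPairs.filter⁺ inR? asc)
        (λ q∈ r∈ → px-inj (QR⊆ q∈) (QR⊆ r∈)) (proj₂ ∘ ∈-filter⁻ inR? {xs = Q})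
      cs , u , v , le = crossing-charges
  in
    csˡ ++ (csʳ ++ cs) ,
    -- A charge from both subtrees would put one point on both sides of the cut; the new charges are
    -- valid in neither half.
    Unique.++⁺ uˡ (Unique.++⁺ uʳ u λ (∈ʳ , ∈c) → proj₂ (proj₂ (All.lookup v ∈c)) (All.lookup vʳ ∈ʳ))
      (λ (∈ˡ , ∈rest) → [ (λ ∈ʳ → exclusive (All.lookup vˡ ∈ˡ) (All.lookup vʳ ∈ʳ))
                        , (λ ∈c → proj₁ (proj₂ (All.lookup v ∈c)) (All.lookup vˡ ∈ˡ)) ]′ (∈-++⁻ csʳ ∈rest)) ,
    All.++⁺ (All.map (λ {c} → Valid-mono QL⊆ QL-convex {c}) vˡ)
      (All.++⁺ (All.map (λ {c} → Valid-mono QR⊆ QR-convex {c}) vʳ) (All.map proj₁ v)) ,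
    subst₂ (λ c n → 3 + Alt (node l r) Q ≤ 2 * c + 3 * n)
      (sym (trans (length-++ csˡ) (cong (length csˡ +_) (length-++ csʳ))))
      (sym (length-++ (leaves l)))
      (arith {cˡ = length csˡ} {cʳ = length csʳ} {nˡ = length (leaves l)} leˡ leʳ le)
  where
  incˡ = proj₁ (AllPairs-++⁻ (leaves l) inc)
  incʳ = proj₁ (proj₂ (AllPairs-++⁻ (leaves l) inc))
  separated : ∀ {x y} → x ∈ leaves l → y ∈ leaves r → x < y
  separated = proj₂ (proj₂ (AllPairs-++⁻ (leaves l) inc))
  -- These tests are the ones in `Alt`, so `QL` and `QR` compute to the point sets of its recursive
  -- calls.
  inL? : Decidable (λ q → px q ∈ leaves l)
  inL? q = px q ∈? leaves l
  inR? : Decidable (λ q → px q ∈ leaves r)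
  inR? q = px q ∈? leaves r
  open Split inL? inR? separated asc px-inj
    (λ q∈ → ∈-++⁻ (leaves l) (labels q∈))
  QL⊆ : ∀ {q} → q ∈ QL → q ∈ Q
  QL⊆ = proj₁ ∘ ∈-filter⁻ inL?
  QR⊆ : ∀ {q} → q ∈ QR → q ∈ Q
  QR⊆ = proj₁ ∘ ∈-filter⁻ inR?
  QL-convex : ∀ {q a b} → q ∈ Q → a ∈ QL → b ∈ QL → px a < px q → px q < px b → q ∈ QL
  QL-convex q∈ _ b∈ _ q<b with ∈-++⁻ (leaves l) (labels q∈)
  ... | inj₁ q∈l = ∈-filter⁺ inL? q∈ q∈l
  ... | inj₂ q∈r = contradiction q<b (<⇒≯ (separated (proj₂ (∈-filter⁻ inL? {xs = Q} b∈)) q∈r))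
  QR-convex : ∀ {q a b} → q ∈ Q → a ∈ QR → b ∈ QR → px a < px q → px q < px b → q ∈ QR
  QR-convex q∈ a∈ _ a<q _ with ∈-++⁻ (leaves l) (labels q∈)
  ... | inj₂ q∈r = ∈-filter⁺ inR? q∈ q∈r
  ... | inj₁ q∈l = contradiction a<q (<⇒≯ (separated q∈l (proj₂ (∈-filter⁻ inR? {xs = Q} a∈))))
  member : ∀ {S c} → Valid S c → ∃ λ q → q ∈ S × (∀ {S′} → Valid S′ c → q ∈ S′)
  member {c = rect p a b} (_ , z) = p , ZRect.p∈ z , λ (_ , z′) → ZRect.p∈ z′
  member {c = up z} (z∈ , _) = z , z∈ , proj₁
  member {c = down z} (z∈ , _) = z , z∈ , proj₁
  exclusive : ∀ {c} → Valid QL c → ¬ Valid QR c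
  exclusive {c} vˡ vʳ with q , q∈ , in-all ← member {c = c} vˡ =
    disjoint {q} (proj₂ (∈-filter⁻ inL? {xs = Q} q∈)) (proj₂ (∈-filter⁻ inR? {xs = Q} (in-all vʳ)))
  arith : ∀ {k aˡ aʳ cˡ cʳ c nˡ nʳ} → 3 + aˡ ≤ 2 * cˡ + 3 * nˡ → 3 + aʳ ≤ 2 * cʳ + 3 * nʳ → k ≤ 3 + 2 * c →
    3 + (k + aˡ + aʳ) ≤ 2 * (cˡ + (cʳ + c)) + 3 * (nˡ + nʳ)
  arith {k} {aˡ} {aʳ} {cˡ} {cʳ} {c} {nˡ} {nʳ} hˡ hʳ h = +-cancelˡ-≤ 3 _ _
    (subst₂ _≤_ (lhs k aˡ aʳ) (rhs cˡ cʳ c nˡ nʳ) (+-mono-≤ (+-mono-≤ hˡ hʳ) h))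
    where
    lhs : ∀ k aˡ aʳ → 3 + aˡ + (3 + aʳ) + k ≡ 3 + (3 + (k + aˡ + aʳ))
    lhs = solve-∀
    rhs : ∀ cˡ cʳ c nˡ nʳ →
      2 * cˡ + 3 * nˡ + (2 * cʳ + 3 * nʳ) + (3 + 2 * c) ≡ 3 + (2 * (cˡ + (cʳ + c)) + 3 * (nˡ + nʳ))
    rhs = solve-∀

-- Letter changes, recorded by points.

module _ (ℓ : Point → Letter) where

  -- Here `w` is the point preceding the list; a change is recorded by the point that starts the new
  -- block.
  changePoints : Point → List Point → List Point
  changePoints w [] = []
  changePoints w (c ∷ W) = if does (ℓ w ≟L ℓ c) then changePoints c W else c ∷ changePoints c W

  length-changePoints : ∀ w W → length (changePoints w W) ≡ changes (ℓ w) (map ℓ W)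
  length-changePoints w [] = refl
  length-changePoints w (c ∷ W) with ℓ w ≟L ℓ c
  ... | yes _ = length-changePoints c W
  ... | no _ = cong suc (length-changePoints c W)

  -- With no listed height between theirs, `b` comes directly after `d`.
  ∈-changePoints : ∀ {w W d b} → Ascending (w ∷ W) → d ∈ w ∷ W → b ∈ W → py d < py b → ℓ d ≢ ℓ b →
    (∀ {q} → q ∈ W → py d < py q → ¬ (py q < py b)) → b ∈ changePoints w W
  ∈-changePoints {w} {c ∷ W} (w< ∷ c< ∷ as) d∈ (here refl) d<b ne adj with d∈
  ... | there (here refl) = contradiction d<b (<-irrefl refl)
  ... | there (there d∈W) = contradiction d<b (<⇒≯ (All.lookup c< d∈W))
  ... | here refl with ℓ w ≟L ℓ c
  ...   | yes e = contradiction e ne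
  ...   | no _ = here refl
  ∈-changePoints {w} {c ∷ W} ((w<c ∷ _) ∷ as) (here refl) (there b∈) d<b ne adj =
    contradiction (All.lookup (AllPairs.head as) b∈) (adj (here refl) w<c)
  ∈-changePoints {w} {c ∷ W} (_ ∷ as) (there d∈) (there b∈) d<b ne adj
    with ℓ w ≟L ℓ c | ∈-changePoints as d∈ b∈ d<b ne (λ q∈ → adj (there q∈))
  ... | yes _ | b∈′ = b∈′
  ... | no _  | b∈′ = there b∈′

  blockChanges : List Point → List Point
  blockChanges [] = []
  blockChanges (w ∷ W) = changePoints w W

  length-blockChanges : ∀ W → length (blockChanges W) ≤ blocks (map ℓ W)
  length-blockChanges [] = z≤n
  length-blockChanges (w ∷ W) = m≤n⇒m≤1+n (≤-reflexive (length-changePoints w W))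

  ∈-blockChanges : ∀ {W d b} → Ascending W → d ∈ W → b ∈ W → py d < py b → ℓ d ≢ ℓ b →
    (∀ {q} → q ∈ W → py d < py q → ¬ (py q < py b)) → b ∈ blockChanges W
  ∈-blockChanges as d∈ (there b∈) d<b ne adj = ∈-changePoints as d∈ b∈ d<b ne (λ q∈ → adj (there q∈))
  ∈-blockChanges as (here refl) (here refl) d<b ne adj = contradiction d<b (<-irrefl refl)
  ∈-blockChanges (w< ∷ _) (there d∈) (here refl) d<b ne adj = contradiction d<b (<⇒≯ (All.lookup w< d∈))

inRect⁺ : ∀ s {p q r} → px q ≺[ s ] px r → px r ≺[ s ] px p → py q < py r → py r < py p → InRect p q r
inRect⁺ 𝙻 {p} {q} x₁ x₂ y₁ y₂ =
  (≤-trans (m⊓n≤n (px p) (px q)) (<⇒≤ x₁) , ≤-trans (<⇒≤ x₂) (m≤m⊔n (px p) (px q))) ,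
  (≤-trans (m⊓n≤n (py p) (py q)) (<⇒≤ y₁) , ≤-trans (<⇒≤ y₂) (m≤m⊔n (py p) (py q)))
inRect⁺ 𝚁 {p} {q} x₁ x₂ y₁ y₂ =
  (≤-trans (m⊓n≤m (px p) (px q)) (<⇒≤ x₂) , ≤-trans (<⇒≤ x₁) (m≤n⊔m (px p) (px q))) ,
  (≤-trans (m⊓n≤n (py p) (py q)) (<⇒≤ y₁) , ≤-trans (<⇒≤ y₂) (m≤m⊔n (py p) (py q)))

inRect⁻ : ∀ s {p q r} → px q ≺[ s ] px p → py q < py p → InRect p q r →
  ¬ (px r ≺[ s ] px q) × ¬ (px p ≺[ s ] px r) × py q ≤ py r × py r ≤ py p
inRect⁻ 𝙻 {p} {q} {r} x y ((x₁ , x₂) , y₁ , y₂) =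
  ≤⇒≯ (subst (_≤ px r) (m≥n⇒m⊓n≡n (<⇒≤ x)) x₁) , ≤⇒≯ (subst (px r ≤_) (m≥n⇒m⊔n≡m (<⇒≤ x)) x₂) ,
  subst (_≤ py r) (m≥n⇒m⊓n≡n (<⇒≤ y)) y₁ , subst (py r ≤_) (m≥n⇒m⊔n≡m (<⇒≤ y)) y₂
inRect⁻ 𝚁 {p} {q} {r} x y ((x₁ , x₂) , y₁ , y₂) =
  ≤⇒≯ (subst (px r ≤_) (m≤n⇒m⊔n≡n (<⇒≤ x)) x₂) , ≤⇒≯ (subst (_≤ px r) (m≤n⇒m⊓n≡m (<⇒≤ x)) x₁) ,
  subst (_≤ py r) (m≥n⇒m⊓n≡n (<⇒≤ y)) y₁ , subst (py r ≤_) (m≥n⇒m⊔n≡m (<⇒≤ y)) y₂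

-- Charging rectangles to funnel alternations.

module _ {P : List Point} (asc : Ascending P) (px-inj : px-Injective P) where

  InFunnel : Letter → Point → Point → Set
  InFunnel s p q = py q < py p × px q ≺[ s ] px p × RectEmpty P p q

  funnelL? : ∀ p → Decidable (InFunnel 𝙻 p)
  funnelL? p q = (py q <? py p) ×-dec ((px q <? px p) ×-dec rectEmpty? P p q)

  funnelR? : ∀ p → Decidable (InFunnel 𝚁 p)
  funnelR? p q = (py q <? py p) ×-dec ((px p <? px q) ×-dec rectEmpty? P p q)

  funnel-disjoint : ∀ {p q} → InFunnel 𝙻 p q → ¬ InFunnel 𝚁 p q
  funnel-disjoint (_ , x , _) (_ , x′ , _) = <⇒≯ x x′

  funnel? : ∀ p → Decidable (λ q → InFunnel 𝙻 p q ⊎ InFunnel 𝚁 p q)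
  funnel? p = A∪B? (funnelL? p) (funnelR? p) funnel-disjoint

  funnelChanges : Point → List Point
  funnelChanges p = blockChanges (letter (funnelL? p)) (filter (funnel? p) P)

  length-funnelChanges : ∀ p → length (funnelChanges p) ≤ f P p
  length-funnelChanges p = ≤-trans (length-blockChanges _ (filter (funnel? p) P))
    (≤-reflexive (cong blocks (sym (mix-filter (funnelL? p) (funnelR? p) funnel-disjoint asc))))

  -- Funnels require the closed rectangle to be empty. A further point on its boundary would share a
  -- coordinate with `p` or `q`, so the open rectangle suffices.
  inFunnel⁺ : ∀ s {p q} → p ∈ P → q ∈ P → py q < py p → px q ≺[ s ] px p →
    (∀ {r} → r ∈ P → py q < py r → py r < py p → px q ≺[ s ] px r → ¬ (px r ≺[ s ] px p)) →
    InFunnel s p q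
  inFunnel⁺ s {p} {q} p∈ q∈ q<p q≺p empty = q<p , q≺p , All.tabulate separate
    where
    separate : ∀ {r} → r ∈ P → r ≡ p ⊎ (r ≡ q ⊎ ¬ InRect p q r)
    separate {r} r∈ with r ≟P p | r ≟P q
    ... | yes e | _ = inj₁ e
    ... | no _  | yes e = inj₂ (inj₁ e)
    ... | no r≢p | no r≢q = inj₂ (inj₂ outside)
      where
      outside : ¬ InRect p q r
      outside i with x₁ , x₂ , y₁ , y₂ ← inRect⁻ s q≺p q<p i with ≺-tri s (px q) (px r) | ≺-tri s (px r) (px p)
      ... | inj₂ (inj₁ e) | _ = r≢q (sym (px-inj q∈ r∈ e))
      ... | inj₂ (inj₂ lt) | _ = x₁ lt
      ... | inj₁ _ | inj₂ (inj₁ e) = r≢p (px-inj r∈ p∈ e)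
      ... | inj₁ _ | inj₂ (inj₂ lt) = x₂ lt
      ... | inj₁ q≺r | inj₁ r≺p = empty r∈
        (≤∧≢⇒< y₁ (λ e → r≢q (sym (ascending-py-injective asc q∈ r∈ e))))
        (≤∧≢⇒< y₂ (λ e → r≢p (ascending-py-injective asc r∈ p∈ e))) q≺r r≺p

  funnel-empty : ∀ s {p q r} → px q ≺[ s ] px p → RectEmpty P p q → r ∈ P →
    py q < py r → py r < py p → px q ≺[ s ] px r → ¬ (px r ≺[ s ] px p)
  funnel-empty s q≺p em r∈ y₁ y₂ x₁ x₂ with All.lookup em r∈
  ... | inj₁ refl = <-irrefl refl y₂
  ... | inj₂ (inj₁ refl) = <-irrefl refl y₁
  ... | inj₂ (inj₂ out) = out (inRect⁺ s x₁ x₂ y₁ y₂)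

  letter-funnel : ∀ s {p q} → InFunnel s p q → letter (funnelL? p) q ≡ s
  letter-funnel 𝙻 {p} i = letter-𝙻 (funnelL? p) i
  letter-funnel 𝚁 {p} i = letter-𝚁 (funnelL? p) (λ i′ → funnel-disjoint i′ i)

  ∈-funnel : ∀ s {p q} → q ∈ P → InFunnel s p q → q ∈ filter (funnel? p) P
  ∈-funnel 𝙻 {p} q∈ i = ∈-filter⁺ (funnel? p) q∈ (inj₁ i)
  ∈-funnel 𝚁 {p} q∈ i = ∈-filter⁺ (funnel? p) q∈ (inj₂ i)

  sides : ∀ s {p q} → InFunnel 𝙻 p q ⊎ InFunnel 𝚁 p q → (px q ≺[ s ] px p ⊎ px p ≺[ s ] px q) × RectEmpty P p q
  sides 𝙻 (inj₁ (_ , x , e)) = inj₁ x , e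
  sides 𝙻 (inj₂ (_ , x , e)) = inj₂ x , e
  sides 𝚁 (inj₁ (_ , x , e)) = inj₂ x , e
  sides 𝚁 (inj₂ (_ , x , e)) = inj₁ x , e

  -- The rectangles spanned by `p` with `d` and with `b` have their interiors inside the empty one,
  -- so `d` and `b` are in the funnel of `p`, on opposite sides. It remains to see that they are
  -- consecutive there.
  ZRect⇒change : ∀ {s p a b} → ZRect s P p a b → b ∈ funnelChanges p
  ZRect⇒change {s} {p} {a} {b} z = ∈-blockChanges _ (AllPairs.filter⁺ (funnel? p) asc)
    (∈-funnel s d∈ Fd) (∈-funnel (opposite s) b∈ Fb) d<b letters adjacent
    where
    open ZRect z
    b<p = <-trans b<a a<p
    Fd : InFunnel s p d
    Fd = inFunnel⁺ s p∈ d∈ (<-trans d<b b<p) d≺p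
      λ r∈ y₁ y₂ x₁ x₂ → empty r∈ y₁ y₂ (≺-trans s a≺d x₁) (≺-trans s x₂ p≺b)
    Fb : InFunnel (opposite s) p b
    Fb = inFunnel⁺ (opposite s) p∈ b∈ b<p (≺-flip s p≺b)
      λ r∈ y₁ y₂ x₁ x₂ → empty r∈ (<-trans d<b y₁) y₂
        (≺-trans s a≺d (≺-trans s d≺p (≺-unflip s x₂))) (≺-unflip s x₁)
    s≢opposite : ∀ s → s ≢ opposite s
    s≢opposite 𝙻 ()
    s≢opposite 𝚁 ()
    letters : letter (funnelL? p) d ≢ letter (funnelL? p) b
    letters e = s≢opposite s (trans (sym (letter-funnel s Fd)) (trans e (letter-funnel (opposite s) Fb)))
    adjacent : ∀ {q} → q ∈ filter (funnel? p) P → py d < py q → ¬ (py q < py b)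
    -- A funnel point between `d` and `b` in height is either inside the empty rectangle or beyond
    -- one of its vertical sides; then that side, `a` or `b`, lies between it and `p` and expels it
    -- from the funnel.
    adjacent {q} q∈F d<q q<b with q∈ , Fq ← ∈-filter⁻ (funnel? p) {xs = P} q∈F
      with sides s Fq | ≺-tri s (px q) (px a) | ≺-tri s (px q) (px b)
    ... | inj₁ q≺p , em | inj₁ q≺a | _ =
      funnel-empty s q≺p em a∈ (<-trans q<b b<a) a<p q≺a (≺-trans s a≺d d≺p)
    ... | inj₁ q≺p , em | inj₂ (inj₁ e) | _ = <⇒≢ (<-trans q<b b<a) (cong py (px-inj q∈ a∈ e))
    ... | inj₁ q≺p , em | inj₂ (inj₂ a≺q) | _ = empty q∈ d<q (<-trans q<b b<p) a≺q (≺-trans s q≺p p≺b)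
    ... | inj₂ p≺q , em | _ | inj₁ q≺b =
      empty q∈ d<q (<-trans q<b b<p) (≺-trans s a≺d (≺-trans s d≺p p≺q)) q≺b
    ... | inj₂ p≺q , em | _ | inj₂ (inj₁ e) = <⇒≢ q<b (cong py (px-inj q∈ b∈ e))
    ... | inj₂ p≺q , em | _ | inj₂ (inj₂ b≺q) =
      funnel-empty (opposite s) (≺-flip s p≺q) em b∈ q<b b<p (≺-flip s b≺q) (≺-flip s p≺b)

  -- The side of `p` on which `b` lies fixes the orientation. Of two different candidates for `a`,
  -- the one nearer to `p` would be inside the empty rectangle of the other.
  ZRect-left-unique : ∀ {s s′ p a a′ b} → ZRect s P p a b → ZRect s′ P p a′ b → a ≡ a′
  ZRect-left-unique {s} {s′} {p} {a} {a′} {b} z z′ = any-sides s s′ z z′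
    where
    same-side : ∀ s → ZRect s P p a b → ZRect s P p a′ b → a ≡ a′
    same-side s z z′ with ≺-tri s (px a) (px a′)
    ... | inj₁ lt = ⊥-elim (Z.empty Z′.a∈ (<-trans Z.d<b Z′.b<a) Z′.a<p lt
            (≺-trans s Z′.a≺d (≺-trans s Z′.d≺p Z.p≺b)))
      where module Z = ZRect z
            module Z′ = ZRect z′
    ... | inj₂ (inj₁ e) = px-inj (ZRect.a∈ z) (ZRect.a∈ z′) e
    ... | inj₂ (inj₂ gt) = ⊥-elim (Z′.empty Z.a∈ (<-trans Z′.d<b Z.b<a) Z.a<p gt
            (≺-trans s Z.a≺d (≺-trans s Z.d≺p Z.p≺b)))
      where module Z = ZRect z
            module Z′ = ZRect z′
    any-sides : ∀ s s′ → ZRect s P p a b → ZRect s′ P p a′ b → a ≡ a′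
    any-sides 𝙻 𝙻 = same-side 𝙻
    any-sides 𝚁 𝚁 = same-side 𝚁
    any-sides 𝙻 𝚁 z z′ = contradiction (ZRect.p≺b z) (<⇒≯ (ZRect.p≺b z′))
    any-sides 𝚁 𝙻 z z′ = contradiction (ZRect.p≺b z) (<⇒≯ (ZRect.p≺b z′))

  -- A rectangle is remembered only by its top and one block start in the funnel of the top, since
  -- these determine its other vertical side.
  Slot : Set
  Slot = (Point × Point) ⊎ (Point ⊎ Point)

  slot : Charge → Slot
  slot (rect p a b) = inj₁ (p , b)
  slot (up z) = inj₂ (inj₁ z)
  slot (down z) = inj₂ (inj₂ z)

  changePairs : List Point → List (Point × Point)
  changePairs = concatMap (λ p → map (p ,_) (funnelChanges p))

  length-changePairs : ∀ ps → length (changePairs ps) ≤ sum (map (f P) ps)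
  length-changePairs [] = z≤n
  length-changePairs (p ∷ ps) = ≤-trans
    (≤-reflexive (trans (length-++ (map (p ,_) (funnelChanges p)))
      (cong (_+ length (changePairs ps)) (length-map (p ,_) (funnelChanges p)))))
    (+-mono-≤ (length-funnelChanges p) (length-changePairs ps))

  slots : List Slot
  slots = map inj₁ (changePairs P) ++ (map (inj₂ ∘ inj₁) P ++ map (inj₂ ∘ inj₂) P)

  length-slots : length slots ≤ Funnel P + (length P + length P)
  length-slots = ≤-trans (≤-reflexive len) (+-monoˡ-≤ _ (length-changePairs P))
    where
    len : length slots ≡ length (changePairs P) + (length P + length P)
    len = trans (length-++ (map inj₁ (changePairs P)))
      (cong₂ _+_ (length-map inj₁ (changePairs P))
        (trans (length-++ (map (inj₂ ∘ inj₁) P)) (cong₂ _+_ (length-map _ P) (length-map _ P))))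

  slot∈slots : ∀ {c} → Valid P c → slot c ∈ slots
  slot∈slots {rect p a b} (_ , z) = ∈-++⁺ˡ (∈-map⁺ inj₁ (∈-concatMap⁺ (λ p → map (p ,_) (funnelChanges p))
    (Any.map (λ { refl → ∈-map⁺ (p ,_) (ZRect⇒change z) }) (ZRect.p∈ z))))
  slot∈slots {up z} (z∈ , _) = ∈-++⁺ʳ (map inj₁ (changePairs P)) (∈-++⁺ˡ (∈-map⁺ (inj₂ ∘ inj₁) z∈))
  slot∈slots {down z} (z∈ , _) =
    ∈-++⁺ʳ (map inj₁ (changePairs P)) (∈-++⁺ʳ (map (inj₂ ∘ inj₁) P) (∈-map⁺ (inj₂ ∘ inj₂) z∈))

  slot-injective : ∀ {c c′} → Valid P c → Valid P c′ → slot c ≡ slot c′ → c ≡ c′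
  slot-injective {rect p a b} {rect _ a′ _} (_ , z) (_ , z′) refl =
    cong (λ a → rect p a b) (ZRect-left-unique z z′)
  slot-injective {up _}   {up _}   _ _ refl = refl
  slot-injective {down _} {down _} _ _ refl = refl

  charges-bound : ∀ {cs} → Unique cs → All (Valid P) cs → length cs ≤ Funnel P + (length P + length P)
  charges-bound u v = ≤-trans
    (length-injection slot u (λ {c} c∈ → slot∈slots {c} (All.lookup v c∈))
      (λ c∈ c′∈ → slot-injective (All.lookup v c∈) (All.lookup v c′∈)))
    length-slots

-- The points of an access sequence, and the constant.

∈-zip⁻ : ∀ xs {ys q} → q ∈ zip xs ys → px q ∈ xs × py q ∈ ys
∈-zip⁻ (x ∷ xs) {y ∷ ys} (here refl) = here refl , here refl
∈-zip⁻ (x ∷ xs) {y ∷ ys} (there q∈) with x∈ , y∈ ← ∈-zip⁻ xs q∈ = there x∈ , there y∈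

zip-ascending : ∀ xs {ys} → AllPairs _<_ ys → Ascending (zip xs ys)
zip-ascending [] _ = []
zip-ascending (_ ∷ _) [] = []
zip-ascending (x ∷ xs) (y< ∷ as) = All.tabulate (λ q∈ → All.lookup y< (proj₂ (∈-zip⁻ xs q∈))) ∷ zip-ascending xs as

zip-px-injective : ∀ {xs} ys → Unique xs → px-Injective (zip xs ys)
zip-px-injective (y ∷ ys) (_ ∷ _) (here refl) (here refl) _ = refl
zip-px-injective (y ∷ ys) (x∉ ∷ _) (here refl) (there r∈) e =
  contradiction e (All.lookup x∉ (proj₁ (∈-zip⁻ _ r∈)))
zip-px-injective (y ∷ ys) (x∉ ∷ _) (there q∈) (here refl) e =
  contradiction (sym e) (All.lookup x∉ (proj₁ (∈-zip⁻ _ q∈)))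
zip-px-injective (y ∷ ys) (_ ∷ u) (there q∈) (there r∈) e = zip-px-injective ys u q∈ r∈ e

G-ascending : ∀ X → Ascending (G X)
G-ascending X = zip-ascending X (AllPairs.map⁺ (AllPairs.applyUpTo⁺₁ _ _ λ i<j _ → s≤s i<j))

length-G : ∀ X → length (G X) ≤ length X
length-G X = ≤-trans (≤-reflexive (length-zipWith _,_ X (map suc (upTo (length X))))) (m⊓n≤m _ _)

Alt≤ : ∀ {m} X → length X ≡ m → Unique X → ∀ T → IsRefTree T (G X) → Alt T (G X) ≤ 7 * (Funnel (G X) + m)
Alt≤ X refl u T (linked , perm) = bound
  (charges T (Linked.Linked⇒AllPairs <-trans linked) asc px-inj
    (λ q∈ → ∈-resp-↭ (↭-sym perm) (∈-map⁺ px q∈)))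
  where
  asc = G-ascending X
  px-inj : px-Injective (G X)
  px-inj = zip-px-injective (map suc (upTo (length X))) u
  F = Funnel (G X)
  m = length X
  regroup : ∀ F m → 2 * (F + (m + m)) + 3 * m + 5 * F ≡ 7 * (F + m)
  regroup = solve-∀
  bound : (Σ (List Charge) λ cs → Unique cs × All (Valid (G X)) cs ×
    3 + Alt T (G X) ≤ 2 * length cs + 3 * length (leaves T)) → Alt T (G X) ≤ 7 * (F + m)
  bound (cs , ucs , valid , le) = begin
    Alt T (G X)                               ≤⟨ m≤n+m _ 3 ⟩
    3 + Alt T (G X)                           ≤⟨ le ⟩
    2 * length cs + 3 * length (leaves T)     ≤⟨ +-mono-≤ (*-monoʳ-≤ 2 cs≤) (*-monoʳ-≤ 3 leaves≤) ⟩
    -- This is `2 * F + 7 * m`; adding `5 * F` evens out the coefficients and gives the constant 7.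
    2 * (F + (m + m)) + 3 * m                 ≤⟨ m≤m+n _ (5 * F) ⟩
    2 * (F + (m + m)) + 3 * m + 5 * F         ≡⟨ regroup F m ⟩
    7 * (F + m)                               ∎
    where
    open ≤-Reasoning
    leaves≤ : length (leaves T) ≤ m
    leaves≤ = ≤-trans (≤-reflexive (trans (↭-length perm) (length-map px (G X)))) (length-G X)
    cs≤ : length cs ≤ F + (m + m)
    cs≤ = ≤-trans (charges-bound asc px-inj ucs valid) (+-monoʳ-≤ F (+-mono-≤ (length-G X) (length-G X)))

theorem1 : Σ ℕ λ C → 0 < C × ((n m : ℕ) (X : List ℕ) → length X ≡ m → All (λ x → 1 ≤ x × x ≤ n) X → Unique X → (T : RefTree) → IsRefTree T (G X) → Alt T (G X) ≤ C * (Funnel (G X) + m))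
theorem1 = 7 , s≤s z≤n , λ n m X len _ u T ref → Alt≤ X len u T ref
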